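{- Let $r\ge3$ be an integer and $0<\varepsilon<1$. There exists $n_0=n_0(r,\varepsilon)$ such that for all $n\ge n_0$ the following holds. Let $0\le t\le\varepsilon\binom{n-3}{r-2}$. If $\mathcal{F}\subseteq\binom{[n]}{r}$ is an intersecting family with diversity $d(\mathcal{F})=\binom{n-3}{r-2}-t$, then one can add at most $3t$ members of $\binom{[n]}{r}$ to $\mathcal{F}$ to obtain a "two out of three" family.
   Context: $\binom{[n]}{r}$ is the set of $r$-subsets of $[n]$. A family is intersecting if every two members intersect. $\Delta(\mathcal{F})$ is the maximum over vertices $x$ of the number of members of $\mathcal{F}$ containing $x$, and the diversity is $d(\mathcal{F}):=|\mathcal{F}|-\Delta(\mathcal{F})$. A "two out of three" family is a family $\mathcal{A}\subseteq\binom{[n]}{r}$ for which there exist three distinct vertices $x,y,z$ such that $\{E\in\binom{[n]}{r}: |E\cap\{x,y,z\}|=2\}\subseteq\mathcal{A}\subseteq\{E\in\binom{[n]}{r}: |E\cap\{x,y,z\}|\ge2\}$. -}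

module Defs where

open import Data.Nat using (ℕ; zero; suc; _+_; _≤_; _⊔_; _∸_)
open import Data.Bool using (Bool; true; false; _∧_; not; T)
open import Data.List using (List; []; _∷_; _++_; map; foldr)
open import Data.Vec using (Vec; []; _∷_; lookup)
open import Data.Fin using (Fin)
open import Data.Fin.Subset using (Subset; ∣_∣; _∩_; Nonempty)
open import Data.Product using (Σ; ∃; _×_; _,_)
open import Relation.Nullary using (¬_)
open import Relation.Binary.PropositionalEquality using (_≡_)

allSubsets : (n : ℕ) → List (Subset n)
allSubsets zero = [] ∷ []
allSubsets (suc n) = map (true ∷_) (allSubsets n) ++ map (false ∷_) (allSubsets n)

countB : {A : Set} → (A → Bool) → List A → ℕ
countB P [] = 0
countB P (a ∷ as) with P a
... | true  = suc (countB P as)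
... | false = countB P as

Family : ℕ → Set
Family n = Subset n → Bool

card : {n : ℕ} → Family n → ℕ
card {n} F = countB F (allSubsets n)

degree : {n : ℕ} → Family n → Fin n → ℕ
degree {n} F x = countB (λ A → F A ∧ lookup A x) (allSubsets n)

-- Δ(F) = max over vertices of the degree (0 if n = 0)
maxDegree : {n : ℕ} → Family n → ℕ
maxDegree {n} F = foldr (λ x m → degree F x ⊔ m) 0 (Data.List.allFin n)

diversity : {n : ℕ} → Family n → ℕ
diversity F = card F ∸ maxDegree F

Uniform : {n : ℕ} → ℕ → Family n → Set
Uniform r F = ∀ A → T (F A) → ∣ A ∣ ≡ r

Intersecting : {n : ℕ} → Family n → Set
Intersecting F = ∀ A B → T (F A) → T (F B) → Nonempty (A ∩ B)

_⊆F_ : {n : ℕ} → Family n → Family n → Set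
F ⊆F G = ∀ A → T (F A) → T (G A)

added : {n : ℕ} → Family n → Family n → ℕ
added {n} F G = countB (λ A → G A ∧ not (F A)) (allSubsets n)

b2n : Bool → ℕ
b2n true = 1
b2n false = 0

-- |E ∩ {x,y,z}| for distinct x, y, z
hits : {n : ℕ} → Fin n → Fin n → Fin n → Subset n → ℕ
hits x y z E = b2n (lookup E x) + b2n (lookup E y) + b2n (lookup E z)

TwoOutOfThree : {n : ℕ} → ℕ → Family n → Set
TwoOutOfThree {n} r G =
  Σ (Fin n) λ x → Σ (Fin n) λ y → Σ (Fin n) λ z →
    ¬ x ≡ y × ¬ y ≡ z × ¬ x ≡ z ×
    (∀ E → ∣ E ∣ ≡ r → hits x y z E ≡ 2 → T (G E)) ×
    (∀ E → T (G E) → ∣ E ∣ ≡ r × 2 ≤ hits x y z E)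

{-# OPTIONS --safe #-}

-- Call a pair of vertices heavy if more than r·C(n-3, r-3) members of F
-- contain it.  A transversal of F with at most r vertices meets every heavy
-- pair, since at most C(n-3, r-3) members contain three given vertices.
-- Members of F are transversals, hence so is every heavy pair, hence any two
-- heavy pairs meet.  If no heavy pair avoids a vertex x, then branching first
-- on a member A of F and then, for u in A, on a member of F avoiding u gives at
-- most r³·C(n-3, r-3) members avoiding x, fewer than the diversity once n is
-- large.  So for every x some heavy pair avoids x, and pairwise meeting pairs
-- with that property contain a triangle abc; every member of F then contains two
-- of its vertices.  At least d(F) members avoid c, all of which have trace
-- {a, b} on the triangle, so at most t of the C(n-3, r-2) sets with that trace
-- are missing; likewise for a and b.

module Submission where

open import Defs
open import Data.Bool using (Bool; true; false; _∧_; _∨_; not; T)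
open import Data.Bool.Properties using (T-∧; T-∨; T-≡; T-not-≡; T?)
open import Data.Empty using (⊥; ⊥-elim)
open import Data.Fin using (Fin; zero; suc; punchOut; _≟_)
open import Data.Fin.Properties using (any?; punchIn-punchOut; punchOut-injective)
open import Data.Fin.Subset using (Subset; ∣_∣; _∩_; Nonempty)
open import Data.List using (List; []; _∷_; _++_; map; foldr; length; allFin)
open import Data.List.Membership.Propositional using (_∈_; _∉_)
open import Data.List.Membership.Propositional.Properties using (∈-allFin; ∈-map⁻)
open import Data.List.Properties using (length-map)
open import Data.List.Relation.Unary.Any using (Any; here; there)
import Data.List.Relation.Unary.Any.Properties as Any
open import Data.Nat
  using (ℕ; zero; suc; _+_; _*_; _∸_; _⊔_; _≤_; _<_; z≤n; s≤s; _≡ᵇ_; _<?_)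
open import Data.Nat.Combinatorics using (_C_; nC1≡n; nCk+nC[k+1]≡[n+1]C[k+1])
open import Data.Nat.Properties hiding (_≟_; _<?_)
open import Data.Nat.Tactic.RingSolver using (solve-∀)
open import Data.Product using (Σ; ∃; _×_; _,_; proj₁; proj₂)
open import Data.Sum using (_⊎_; inj₁; inj₂; [_,_]′)
open import Data.Unit using (tt)
open import Data.Vec using ([]; _∷_; lookup; insertAt; here; there)
open import Data.Vec.Properties using (insertAt-punchIn)
open import Function using (_∘_)
open import Function.Bundles using (Equivalence)
open import Relation.Binary.PropositionalEquality
  using (_≡_; _≢_; refl; sym; trans; cong; cong₂; subst; ≢-sym)
open import Relation.Nullary using (¬_; Dec; yes; no; ¬?; contradiction)
open import Relation.Nullary.Decidable using (_×-dec_)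

-- Booleans as propositions.

∧⁻ : ∀ x {y} → T (x ∧ y) → T x × T y
∧⁻ x {y} = Equivalence.to (T-∧ {x} {y})

∧⁺ : ∀ {x y} → T x → T y → T (x ∧ y)
∧⁺ p q = Equivalence.from T-∧ (p , q)

∨⁻ : ∀ x {y} → T (x ∨ y) → T x ⊎ T y
∨⁻ x {y} = Equivalence.to (T-∨ {x} {y})

∨⁺ : ∀ x {y} → T x ⊎ T y → T (x ∨ y)
∨⁺ x {y} = Equivalence.from (T-∨ {x} {y})

T-not⁻ : ∀ {x} → T (not x) → ¬ T x
T-not⁻ {false} _ ()

T-not⁺ : ∀ {x} → ¬ T x → T (not x)
T-not⁺ {false} _ = tt
T-not⁺ {true} ¬p = ¬p tt

-- Counting

module _ {A : Set} where

  countB-mono : (P Q : A → Bool) → (∀ a → T (P a) → T (Q a)) →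
    ∀ xs → countB P xs ≤ countB Q xs
  countB-mono P Q h [] = z≤n
  countB-mono P Q h (x ∷ xs) with P x | Q x | h x
  ... | true  | true  | _ = s≤s (countB-mono P Q h xs)
  ... | true  | false | f = ⊥-elim (f tt)
  ... | false | true  | _ = m≤n⇒m≤1+n (countB-mono P Q h xs)
  ... | false | false | _ = countB-mono P Q h xs

  countB-none : (P : A → Bool) → (∀ a → ¬ T (P a)) → ∀ xs → countB P xs ≡ 0
  countB-none P h [] = refl
  countB-none P h (x ∷ xs) with P x | h x
  ... | true  | f = ⊥-elim (f tt)
  ... | false | _ = countB-none P h xs

  countB-witness : (P : A → Bool) → ∀ xs → 0 < countB P xs → ∃ λ a → T (P a)
  countB-witness P (x ∷ xs) h with P x in eq
  ... | true  = x , Equivalence.from T-≡ eq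
  ... | false = countB-witness P xs h

  countB-split : (P Q : A → Bool) → ∀ xs →
    countB P xs ≡ countB (λ a → P a ∧ Q a) xs + countB (λ a → P a ∧ not (Q a)) xs
  countB-split P Q [] = refl
  countB-split P Q (x ∷ xs) with P x | Q x
  ... | true  | true  = cong suc (countB-split P Q xs)
  ... | true  | false = trans (cong suc (countB-split P Q xs)) (sym (+-suc _ _))
  ... | false | _     = countB-split P Q xs

  countB-∨ : (P Q : A → Bool) → ∀ xs →
    countB (λ a → P a ∨ Q a) xs ≤ countB P xs + countB Q xs
  countB-∨ P Q [] = z≤n
  countB-∨ P Q (x ∷ xs) with P x | Q x
  ... | true  | true  = s≤s (≤-trans (countB-∨ P Q xs) (+-monoʳ-≤ _ (n≤1+n _)))
  ... | true  | false = s≤s (countB-∨ P Q xs)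
  ... | false | true  = ≤-trans (s≤s (countB-∨ P Q xs)) (≤-reflexive (sym (+-suc _ _)))
  ... | false | false = countB-∨ P Q xs

  countB-++ : (P : A → Bool) → ∀ xs ys → countB P (xs ++ ys) ≡ countB P xs + countB P ys
  countB-++ P [] ys = refl
  countB-++ P (x ∷ xs) ys with P x
  ... | true  = cong suc (countB-++ P xs ys)
  ... | false = countB-++ P xs ys

  countB-map : {B : Set} (P : A → Bool) (f : B → A) → ∀ xs →
    countB P (map f xs) ≡ countB (P ∘ f) xs
  countB-map P f [] = refl
  countB-map P f (x ∷ xs) with P (f x)
  ... | true  = cong suc (countB-map P f xs)
  ... | false = countB-map P f xs

  -- At most `N` elements are caught by the head `u`; the others, collected in `P′`, must be caught
  -- by the tail. With a transversal as `us` this is one round of branching.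
  countB-union : {U : Set} (Q : U → A → Bool) (P : A → Bool) (us : List U) (N : ℕ) (xs : List A) →
    (∀ a → T (P a) → Any (λ u → T (Q u a)) us) →
    (∀ u → u ∈ us → countB (λ a → P a ∧ Q u a) xs ≤ N) →
    countB P xs ≤ length us * N
  countB-union Q P [] N xs cov bd =
    ≤-reflexive (countB-none P (λ a p → Any.¬Any[] (cov a p)) xs)
  countB-union Q P (u ∷ us) N xs cov bd = begin
    countB P xs                                        ≡⟨ countB-split P (Q u) xs ⟩
    countB (λ a → P a ∧ Q u a) xs + countB P′ xs       ≤⟨ +-mono-≤ (bd u (here refl)) ih ⟩
    N + length us * N                                  ∎
    where
    open ≤-Reasoning
    P′ : A → Bool
    P′ a = P a ∧ not (Q u a)
    cov′ : ∀ a → T (P′ a) → Any (λ v → T (Q v a)) us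
    cov′ a p with ∧⁻ (P a) p
    ... | pa , ¬q with cov a pa
    ...   | here q  = contradiction q (T-not⁻ ¬q)
    ...   | there i = i
    ih : countB P′ xs ≤ length us * N
    ih = countB-union Q P′ us N xs cov′ λ v v∈ → ≤-trans
      (countB-mono _ (λ a → P a ∧ Q v a)
        (λ a p → let p′ , q = ∧⁻ (P′ a) p in ∧⁺ (proj₁ (∧⁻ (P a) p′)) q) xs)
      (bd v (there v∈))

countB-allSubsets-suc : ∀ {n} (P : Subset (suc n) → Bool) →
  countB P (allSubsets (suc n)) ≡
  countB (λ E → P (true ∷ E)) (allSubsets n) + countB (λ E → P (false ∷ E)) (allSubsets n)
countB-allSubsets-suc {n} P = trans
  (countB-++ P (map (true ∷_) (allSubsets n)) _)
  (cong₂ _+_ (countB-map P (true ∷_) (allSubsets n)) (countB-map P (false ∷_) (allSubsets n)))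

-- Once the membership of `x` is fixed, a set is determined by its restriction to the other `n`
-- vertices, and `insertAt` recovers it.
countB-insertAt : ∀ {n} (x : Fin (suc n)) b (P : Subset (suc n) → Bool) →
  (∀ E → T (P E) → lookup E x ≡ b) →
  countB P (allSubsets (suc n)) ≤ countB (λ E → P (insertAt E x b)) (allSubsets n)
countB-insertAt {n} zero true P h rewrite countB-allSubsets-suc P
  | countB-none (λ E → P (false ∷ E)) (λ E p → contradiction (h _ p) λ ()) (allSubsets n)
  = ≤-reflexive (+-identityʳ _)
countB-insertAt {n} zero false P h rewrite countB-allSubsets-suc P
  | countB-none (λ E → P (true ∷ E)) (λ E p → contradiction (h _ p) λ ()) (allSubsets n)
  = ≤-refl
countB-insertAt {suc n} (suc x) b P h
  rewrite countB-allSubsets-suc P | countB-allSubsets-suc (λ E → P (insertAt E (suc x) b))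
  = +-mono-≤ (countB-insertAt x b (λ E → P (true ∷ E)) (λ E → h (true ∷ E)))
             (countB-insertAt x b (λ E → P (false ∷ E)) (λ E → h (false ∷ E)))

countB-uniform : ∀ n k (P : Subset n → Bool) → (∀ E → T (P E) → ∣ E ∣ ≡ k) →
  countB P (allSubsets n) ≤ n C k
countB-uniform zero k P h with P [] | h []
... | false | _ = z≤n
... | true  | f rewrite sym (f tt) = ≤-refl
countB-uniform (suc n) zero P h rewrite countB-allSubsets-suc P
  | countB-none (λ E → P (true ∷ E)) (λ E p → contradiction (h _ p) λ ()) (allSubsets n)
  = countB-uniform n zero (λ E → P (false ∷ E)) (λ E → h (false ∷ E))
countB-uniform (suc n) (suc k) P h rewrite countB-allSubsets-suc P
  | sym (nCk+nC[k+1]≡[n+1]C[k+1] n k)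
  = +-mono-≤ (countB-uniform n k _ (λ E p → suc-injective (h (true ∷ E) p)))
             (countB-uniform n (suc k) _ (λ E → h (false ∷ E)))

∣insertAt∣ : ∀ {n} (E : Subset n) x b → ∣ insertAt E x b ∣ ≡ b2n b + ∣ E ∣
∣insertAt∣ E zero true = refl
∣insertAt∣ E zero false = refl
∣insertAt∣ (true ∷ E) (suc x) b = trans (cong suc (∣insertAt∣ E x b)) (sym (+-suc (b2n b) _))
∣insertAt∣ (false ∷ E) (suc x) b = ∣insertAt∣ E x b

lookup-insertAt-≢ : ∀ {n} (E : Subset n) {x y} (x≢y : x ≢ y) b →
  lookup (insertAt E x b) y ≡ lookup E (punchOut x≢y)
lookup-insertAt-≢ E {x} x≢y b = trans
  (cong (lookup (insertAt E x b)) (sym (punchIn-punchOut x≢y)))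
  (insertAt-punchIn E x b (punchOut x≢y))

-- Deleting the three vertices one after another leaves a `k`-subset of `m` vertices. The trace with
-- all three vertices serves for codegrees, the trace with exactly two for the final completion.
countB-trace : ∀ {m} k {x y z : Fin (3 + m)} → x ≢ y → x ≢ z → y ≢ z →
  ∀ b c d (P : Subset (3 + m) → Bool) →
  (∀ E → T (P E) →
    ∣ E ∣ ≡ b2n b + (b2n c + (b2n d + k)) ×
    lookup E x ≡ b × lookup E y ≡ c × lookup E z ≡ d) →
  countB P (allSubsets (3 + m)) ≤ m C k
countB-trace {m} k {x} {y} {z} x≢y x≢z y≢z b c d P h = begin
  countB P (allSubsets (3 + m))   ≤⟨ countB-insertAt x b P (λ E p → proj₁ (proj₂ (h E p))) ⟩
  countB P₁ (allSubsets (2 + m))  ≤⟨ countB-insertAt y′ c P₁ (λ E p →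
                                       trans (sym (lookup-insertAt-≢ E x≢y b))
                                             (proj₁ (proj₂ (proj₂ (h _ p))))) ⟩
  countB P₂ (allSubsets (1 + m))  ≤⟨ countB-insertAt z″ d P₂ (λ E p →
                                       trans (sym (lookup-insertAt-≢ E y′≢z′ c))
                                       (trans (sym (lookup-insertAt-≢ _ x≢z b))
                                              (proj₂ (proj₂ (proj₂ (h _ p)))))) ⟩
  countB P₃ (allSubsets m)        ≤⟨ countB-uniform m k P₃ size ⟩
  m C k                           ∎
  where
  open ≤-Reasoning
  -- Each deletion renumbers the surviving vertices: `z` is renumbered twice, and stays distinct
  -- from `y` because `punchOut` is injective.
  y′ = punchOut x≢y
  z′ = punchOut x≢z
  y′≢z′ : y′ ≢ z′
  y′≢z′ eq = y≢z (punchOut-injective x≢y x≢z eq)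
  z″ = punchOut y′≢z′
  P₁ : Subset (2 + m) → Bool
  P₁ E = P (insertAt E x b)
  P₂ : Subset (1 + m) → Bool
  P₂ E = P₁ (insertAt E y′ c)
  P₃ : Subset m → Bool
  P₃ E = P₂ (insertAt E z″ d)
  size : ∀ E → T (P₃ E) → ∣ E ∣ ≡ k
  size E p = +-cancelˡ-≡ (b2n d) _ _ (+-cancelˡ-≡ (b2n c) _ _ (+-cancelˡ-≡ (b2n b) _ _
    (trans (sym (trans (∣insertAt∣ _ x b)
                (cong (b2n b +_) (trans (∣insertAt∣ _ y′ c)
                (cong (b2n c +_) (∣insertAt∣ E z″ d))))))
           (proj₁ (h _ p)))))

-- Binomial coefficients

-- This is (k+1) C(m, k+1) = (m-k) C(m, k) with the subtracted term moved to the left, so that no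
-- truncated subtraction occurs. Pascal's rule reduces it to the instances `suc k` and `k` at the
-- smaller `m`.
C-absorption : ∀ m k → suc k * (m C suc k) + k * (m C k) ≡ m * (m C k)
C-absorption m zero = trans (collapse (m C 1)) (trans (nC1≡n m) (sym (*-identityʳ m)))
  where
  collapse : ∀ a → 1 * a + 0 ≡ a
  collapse = solve-∀
C-absorption zero (suc k) = cong₂ _+_ (*-zeroʳ k) (*-zeroʳ k)
C-absorption (suc m) (suc k)
  rewrite sym (nCk+nC[k+1]≡[n+1]C[k+1] m k) | sym (nCk+nC[k+1]≡[n+1]C[k+1] m (suc k))
  = trans (regroup k (m C k) (m C suc k) (m C suc (suc k)))
    (trans (cong₂ (λ u v → u + v + (m C suc k + m C k)) (C-absorption m (suc k)) (C-absorption m k))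
           (collect m (m C k) (m C suc k)))
  where
  regroup : ∀ k a b c →
    suc (suc k) * (b + c) + suc k * (a + b) ≡
    (suc (suc k) * c + suc k * b) + (suc k * b + k * a) + (b + a)
  regroup = solve-∀
  collect : ∀ m a b → m * b + m * a + (b + a) ≡ suc m * (a + b)
  collect = solve-∀

C-positive : ∀ {m k} → k ≤ m → 0 < m C k
C-positive {m} {zero} _ = s≤s z≤n
C-positive {suc m} {suc k} (s≤s k≤m) rewrite sym (nCk+nC[k+1]≡[n+1]C[k+1] m k) =
  ≤-trans (C-positive k≤m) (m≤m+n _ _)

-- The ratio of the two binomials is (m-k)/(k+1), which exceeds any constant `W` once `m` passes a
-- bound linear in `W`.
C-growth : ∀ m k W → k + suc (suc k * W) ≤ m → W * (m C k) < m C suc k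
C-growth m k W large = *-cancelˡ-< (suc k) _ _ (+-cancelʳ-< (k * c) _ _ (begin-strict
  suc k * (W * c) + k * c       <⟨ n<1+n _ ⟩
  -- The extra `suc` in the threshold supplies one spare copy of `c`, and `c` being positive gives
  -- strictness.
  1 + (suc k * (W * c) + k * c) ≤⟨ +-monoˡ-≤ _ (C-positive k≤m) ⟩
  c + (suc k * (W * c) + k * c) ≡⟨ collect k W c ⟩
  (k + suc (suc k * W)) * c     ≤⟨ *-monoˡ-≤ c large ⟩
  m * c                         ≡⟨ C-absorption m k ⟨
  suc k * (m C suc k) + k * c   ∎))
  where
  open ≤-Reasoning
  c = m C k
  k≤m : k ≤ m
  k≤m = ≤-trans (m≤m+n k _) large
  collect : ∀ k W c → c + (suc k * (W * c) + k * c) ≡ (k + suc (suc k * W)) * c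
  collect = solve-∀

-- Here qd = qN - qt is at least (q-p)N, hence at least N, since q - p is at least 1. The proof adds
-- pN to both sides instead of subtracting.
deficit-bound : ∀ {p q d t N R} → p < q → q * t ≤ p * N → d + t ≡ N → q * R < N → R < d
deficit-bound {p} {q} {d} {t} {N} {R} p<q qt≤pN d+t≡N qR<N =
  *-cancelˡ-< q R d (<-≤-trans qR<N (+-cancelʳ-≤ (p * N) N (q * d) (begin
    N + p * N      ≤⟨ *-monoˡ-≤ N p<q ⟩
    q * N          ≡⟨ cong (q *_) d+t≡N ⟨
    q * (d + t)    ≡⟨ *-distribˡ-+ q d t ⟩
    q * d + q * t  ≤⟨ +-monoʳ-≤ (q * d) qt≤pN ⟩
    q * d + p * N  ∎)))
  where open ≤-Reasoning

-- Elements of a subset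

elements : ∀ {n} → Subset n → List (Fin n)
elements [] = []
elements (true ∷ A) = zero ∷ map suc (elements A)
elements (false ∷ A) = map suc (elements A)

length-elements : ∀ {n} (A : Subset n) → length (elements A) ≡ ∣ A ∣
length-elements [] = refl
length-elements (true ∷ A) = cong suc (trans (length-map suc (elements A)) (length-elements A))
length-elements (false ∷ A) = trans (length-map suc (elements A)) (length-elements A)

∈-elements⁻ : ∀ {n} (A : Subset n) {v} → v ∈ elements A → T (lookup A v)
∈-elements⁻ (true ∷ A) (here refl) = tt
∈-elements⁻ (true ∷ A) (there i) with ∈-map⁻ suc i
... | _ , j , refl = ∈-elements⁻ A j
∈-elements⁻ (false ∷ A) i with ∈-map⁻ suc i
... | _ , j , refl = ∈-elements⁻ A j

elements-meet : ∀ {n} (A E : Subset n) → Nonempty (A ∩ E) → Any (T ∘ lookup E) (elements A)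
elements-meet (true ∷ A) (true ∷ E) (zero , here) = here tt
elements-meet (true ∷ A) (_ ∷ E) (suc v , there i) =
  there (Any.map⁺ (elements-meet A E (v , i)))
elements-meet (false ∷ A) (_ ∷ E) (suc v , there i) =
  Any.map⁺ (elements-meet A E (v , i))

-- Diversity

≤-foldr-⊔ : ∀ {A : Set} (f : A → ℕ) {x} xs → x ∈ xs → f x ≤ foldr (λ y m → f y ⊔ m) 0 xs
≤-foldr-⊔ f (y ∷ xs) (here refl) = m≤m⊔n _ _
≤-foldr-⊔ f (y ∷ xs) (there i) = ≤-trans (≤-foldr-⊔ f xs i) (m≤n⊔m (f y) _)

-- The degree of `x` is at most the maximum degree, and removing it from the total leaves the
-- members avoiding `x`. All later facts about diversity come from this bound.
diversity-≤ : ∀ {n} (F : Family n) x →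
  diversity F ≤ countB (λ E → F E ∧ not (lookup E x)) (allSubsets n)
diversity-≤ {n} F x = begin
  card F ∸ maxDegree F   ≤⟨ ∸-monoʳ-≤ (card F) (≤-foldr-⊔ (degree F) (allFin n) (∈-allFin x)) ⟩
  card F ∸ degree F x    ≡⟨ cong (_∸ degree F x)
                              (countB-split F (λ E → lookup E x) (allSubsets n)) ⟩
  degree F x + avoiding ∸ degree F x
                         ≡⟨ m+n∸m≡n (degree F x) avoiding ⟩
  avoiding               ∎
  where
  open ≤-Reasoning
  avoiding = countB (λ E → F E ∧ not (lookup E x)) (allSubsets n)

Covering : ∀ {n} → Family n → Fin n → Fin n → Set
Covering F a b = ∀ E → T (F E) → T (lookup E a) ⊎ T (lookup E b)

-- Heavy pairs

module _ {m k : ℕ} (F : Family (3 + m))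
         (uniform : Uniform (3 + k) F) (intersecting : Intersecting F) where

  private
    n r c : ℕ
    n = 3 + m
    r = 3 + k
    -- This is C(n-3, r-3), the bound on the number of members through three given vertices.
    c = m C k

  Transversal : List (Fin n) → Set
  Transversal us = ∀ E → T (F E) → Any (T ∘ lookup E) us

  codegree : Fin n → Fin n → ℕ
  codegree a b = countB (λ E → (F E ∧ lookup E a) ∧ lookup E b) (allSubsets n)

  Heavy : Fin n → Fin n → Set
  Heavy a b = a ≢ b × r * c < codegree a b

  heavy? : ∀ a b → Dec (Heavy a b)
  heavy? a b = ¬? (a ≟ b) ×-dec (r * c <? codegree a b)

  heavy-sym : ∀ {a b} → Heavy a b → Heavy b a
  heavy-sym {a} {b} (a≢b , h) = ≢-sym a≢b , <-≤-trans h (countB-mono _ _ swap (allSubsets n))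
    where
    swap : ∀ E → T ((F E ∧ lookup E a) ∧ lookup E b) → T ((F E ∧ lookup E b) ∧ lookup E a)
    swap E p with ∧⁻ (F E ∧ lookup E a) p
    ... | p′ , eb with ∧⁻ (F E) p′
    ...   | fe , ea = ∧⁺ (∧⁺ fe eb) ea

  elements-transversal : ∀ A → T (F A) → Transversal (elements A)
  elements-transversal A fA E fE = elements-meet A E (intersecting A E fA fE)

  length-elements-member : ∀ A → T (F A) → length (elements A) ≡ r
  length-elements-member A fA = trans (length-elements A) (uniform A fA)

  -- Each member through `a` and `b` also contains some `u` of the transversal, a third vertex, and
  -- at most `c` members contain all three.
  codegree-≤ : ∀ us → Transversal us → ∀ {a b} → a ≢ b → a ∉ us → b ∉ us →
    codegree a b ≤ length us * c
  codegree-≤ us trv {a} {b} a≢b a∉us b∉us =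
    countB-union (λ u E → lookup E u) _ us c (allSubsets n)
      (λ E p → trv E (proj₁ (∧⁻ (F E) (proj₁ (∧⁻ (F E ∧ lookup E a) p)))))
      λ u u∈us → countB-trace k a≢b
        (λ { refl → a∉us u∈us }) (λ { refl → b∉us u∈us }) true true true _
        λ E p → let p₁ , eu = ∧⁻ ((F E ∧ lookup E a) ∧ lookup E b) p
                    p₂ , eb = ∧⁻ (F E ∧ lookup E a) p₁
                    fE , ea = ∧⁻ (F E) p₂
                in uniform E fE , Equivalence.to T-≡ ea , Equivalence.to T-≡ eb , Equivalence.to T-≡ eu

  -- A member missing both vertices would be a transversal of size `r` avoiding the pair, which caps
  -- the codegree at `r * c`.
  heavy-covering : ∀ {a b} → Heavy a b → Covering F a b
  heavy-covering {a} {b} (a≢b , h) E fE with T? (lookup E a) | T? (lookup E b)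
  ... | yes p | _     = inj₁ p
  ... | no _  | yes q = inj₂ q
  ... | no ¬p | no ¬q = contradiction
    (≤-trans (codegree-≤ (elements E) (elements-transversal E fE) a≢b
               (¬p ∘ ∈-elements⁻ E) (¬q ∘ ∈-elements⁻ E))
             (≤-reflexive (cong (_* c) (length-elements-member E fE))))
    (<⇒≱ h)

  -- By `heavy-covering` the pair `x`, `y` is a transversal of size 2, so a pair disjoint from it
  -- has codegree at most `2 * c`, too small to be heavy.
  heavy-meet : ∀ {a b x y} → Heavy a b → Heavy x y →
    a ≢ x → a ≢ y → b ≢ x → b ≢ y → ⊥
  heavy-meet {a} {b} {x} {y} (a≢b , h) xy a≢x a≢y b≢x b≢y = <⇒≱ h
    (≤-trans (codegree-≤ (x ∷ y ∷ []) trv a≢b (notin a≢x a≢y) (notin b≢x b≢y))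
             (*-monoˡ-≤ c {2} {r} (s≤s (s≤s z≤n))))
    where
    trv : Transversal (x ∷ y ∷ [])
    trv E fE = [ here , (λ ey → there (here ey)) ]′ (heavy-covering xy E fE)
    notin : ∀ {v} → v ≢ x → v ≢ y → v ∉ (x ∷ y ∷ [])
    notin v≢x v≢y (here e) = v≢x e
    notin v≢x v≢y (there (here e)) = v≢y e

  -- Two rounds of branching give at most `r` choices for `u` and `r` for `v`. A pair `u`, `v` of
  -- distinct vertices other than `x` is not heavy, which accounts for the last factor `r * c`.
  avoiding-≤ : 0 < diversity F → ∀ x →
    ¬ (∃ λ a → ∃ λ b → a ≢ x × b ≢ x × Heavy a b) →
    countB (λ E → F E ∧ not (lookup E x)) (allSubsets n) ≤ r * (r * (r * c))
  avoiding-≤ pos x light = branch x (λ E → F E ∧ not (lookup E x)) (λ E → proj₁ ∘ ∧⁻ (F E))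
      λ u _ → first u
    where
    branch : ∀ w (P : Subset n → Bool) → (∀ E → T (P E) → T (F E)) → ∀ {N} →
      (∀ u → u ≢ w → countB (λ E → P E ∧ lookup E u) (allSubsets n) ≤ N) →
      countB P (allSubsets n) ≤ r * N
    -- Positive diversity yields a member avoiding `w`. Branching on its elements makes every new
    -- vertex differ from `w`: first `w` is `x`, then it is `u`.
    branch w P P⊆F {N} bd with countB-witness _ (allSubsets n) (≤-trans pos (diversity-≤ F w))
    ... | A , p with ∧⁻ (F A) p
    ...   | fA , ¬Aw = ≤-trans
      (countB-union (λ u E → lookup E u) P (elements A) N (allSubsets n)
        (λ E → elements-transversal A fA E ∘ P⊆F E)
        (λ u u∈A → bd u λ { refl → T-not⁻ ¬Aw (∈-elements⁻ A u∈A) }))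
      (≤-reflexive (cong (_* N) (length-elements-member A fA)))

    P₁ : Fin n → Subset n → Bool
    P₁ u E = (F E ∧ not (lookup E x)) ∧ lookup E u

    P₁⊆F : ∀ u E → T (P₁ u E) → T (F E)
    P₁⊆F u E p = proj₁ (∧⁻ (F E) (proj₁ (∧⁻ (F E ∧ not (lookup E x)) p)))

    P₁-avoids : ∀ u E → T (P₁ u E) → ¬ T (lookup E x)
    P₁-avoids u E p = T-not⁻ (proj₂ (∧⁻ (F E) (proj₁ (∧⁻ (F E ∧ not (lookup E x)) p))))

    P₁-contains : ∀ u E → T (P₁ u E) → T (lookup E u)
    P₁-contains u E p = proj₂ (∧⁻ (F E ∧ not (lookup E x)) p)

    second : ∀ u → u ≢ x → ∀ v → v ≢ u →
      countB (λ E → P₁ u E ∧ lookup E v) (allSubsets n) ≤ r * c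
    second u u≢x v v≢u with v ≟ x
    -- The second member is only known to avoid `u`, so it may contain `x`; that branch is empty
    -- because `P₁` counts sets avoiding `x`.
    ... | yes refl = ≤-trans (≤-reflexive (countB-none _
      (λ E p → let p₁ , ev = ∧⁻ (P₁ u E) p in P₁-avoids u E p₁ ev) (allSubsets n))) z≤n
    ... | no v≢x = ≤-trans
      (countB-mono _ _ (λ E p → let p₁ , ev = ∧⁻ (P₁ u E) p in
        ∧⁺ (∧⁺ (P₁⊆F u E p₁) (P₁-contains u E p₁)) ev) (allSubsets n))
      (≮⇒≥ λ h → light (u , v , u≢x , v≢x , ≢-sym v≢u , h))

    first : ∀ u → countB (P₁ u) (allSubsets n) ≤ r * (r * c)
    first u with u ≟ x
    ... | yes refl = ≤-trans (≤-reflexive (countB-none _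
      (λ E p → P₁-avoids u E p (P₁-contains u E p)) (allSubsets n))) z≤n
    ... | no u≢x = branch u (P₁ u) (P₁⊆F u) (second u u≢x)

  module _ (diverse : r * (r * (r * c)) < diversity F) where

    heavy-avoiding : ∀ x → ∃ λ a → ∃ λ b → a ≢ x × b ≢ x × Heavy a b
    heavy-avoiding x with any? (λ a → any? (λ b → ¬? (a ≟ x) ×-dec ¬? (b ≟ x) ×-dec heavy? a b))
    ... | yes e = e
    ... | no ¬e = contradiction
      (≤-trans (diversity-≤ F x) (avoiding-≤ (≤-<-trans z≤n diverse) x ¬e))
      (<⇒≱ diverse)

    -- A heavy pair avoiding `a` must still meet the pair `a`, `b`, hence it contains `b`.
    heavy-neighbour : ∀ {a b} → Heavy a b → ∃ λ x → x ≢ a × x ≢ b × Heavy b x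
    heavy-neighbour {a} {b} ab with heavy-avoiding a
    ... | x , y , x≢a , y≢a , xy with x ≟ b | y ≟ b
    ...   | yes refl | _        = y , y≢a , ≢-sym (proj₁ xy) , xy
    ...   | no _     | yes refl = x , x≢a , proj₁ xy , heavy-sym xy
    ...   | no x≢b   | no y≢b   =
      ⊥-elim (heavy-meet ab xy (≢-sym x≢a) (≢-sym y≢a) (≢-sym x≢b) (≢-sym y≢b))

    -- Extend a heavy pair at either end. The extensions `b x` and `a y` must meet, which forces `x`
    -- and `y` to coincide.
    heavy-triangle : ∃ λ a → ∃ λ b → ∃ λ x → Heavy a b × Heavy b x × Heavy a x
    heavy-triangle with heavy-avoiding zero
    ... | a , b , _ , _ , ab with heavy-neighbour ab | heavy-neighbour (heavy-sym ab)
    ...   | x , x≢a , x≢b , bx | y , y≢b , _ , ay with x ≟ y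
    ...     | yes refl = a , b , x , ab , bx , ay
    ...     | no x≢y   = ⊥-elim (heavy-meet bx ay (≢-sym (proj₁ ab)) (≢-sym y≢b) x≢a x≢y)

-- Completing a family to a "two out of three" family

HasTrace : ∀ {n} → ℕ → (x y z : Fin n) → Subset n → Bool
HasTrace r x y z E = (∣ E ∣ ≡ᵇ r) ∧ (lookup E x ∧ (lookup E y ∧ not (lookup E z)))

-- The two coverings force `x` and `y` into every member avoiding `z`, so at least `diversity F` of
-- the sets with this trace are already present.
trace-deficit : ∀ {m} k (F : Family (3 + m)) → Uniform (3 + k) F → ∀ {t} →
  diversity F + t ≡ m C suc k → ∀ {x y z} → x ≢ y → x ≢ z → y ≢ z →
  Covering F x z → Covering F y z →
  countB (λ E → HasTrace (3 + k) x y z E ∧ not (F E)) (allSubsets (3 + m)) ≤ t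
trace-deficit {m} k F uniform {t} d+t {x} {y} {z} x≢y x≢z y≢z xz yz =
  +-cancelˡ-≤ (diversity F) _ _ (begin
    diversity F + missing   ≤⟨ +-monoˡ-≤ missing (≤-trans (diversity-≤ F z)
                                 (countB-mono _ _ forced (allSubsets n))) ⟩
    present + missing       ≡⟨ countB-split (HasTrace r x y z) F (allSubsets n) ⟨
    countB (HasTrace r x y z) (allSubsets n)
                            -- Two of the `3 + k` elements are fixed by the trace, so `suc k`, that
                            -- is r-2, remain to be chosen.
                            ≤⟨ countB-trace (suc k) x≢y x≢z y≢z true true false _ trace ⟩
    m C suc k               ≡⟨ d+t ⟨
    diversity F + t         ∎)
  where
  open ≤-Reasoning
  n r missing present : ℕ
  n = 3 + m
  r = 3 + k
  missing = countB (λ E → HasTrace r x y z E ∧ not (F E)) (allSubsets n)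
  present = countB (λ E → HasTrace r x y z E ∧ F E) (allSubsets n)
  forced : ∀ E → T (F E ∧ not (lookup E z)) → T (HasTrace r x y z E ∧ F E)
  forced E p with ∧⁻ (F E) p
  ... | fE , ¬z with xz E fE | yz E fE
  ...   | inj₂ ez | _       = contradiction ez (T-not⁻ ¬z)
  ...   | inj₁ _  | inj₂ ez = contradiction ez (T-not⁻ ¬z)
  ...   | inj₁ ex | inj₁ ey = ∧⁺ (∧⁺ (≡⇒≡ᵇ _ r (uniform E fE)) (∧⁺ ex (∧⁺ ey ¬z))) fE
  trace : ∀ E → T (HasTrace r x y z E) →
    ∣ E ∣ ≡ 3 + k × lookup E x ≡ true × lookup E y ≡ true × lookup E z ≡ false
  trace E p with ∧⁻ (∣ E ∣ ≡ᵇ r) p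
  ... | s , p₁ with ∧⁻ (lookup E x) p₁
  ...   | ex , p₂ with ∧⁻ (lookup E y) p₂
  ...     | ey , ¬z = ≡ᵇ⇒≡ _ r s , Equivalence.to T-≡ ex , Equivalence.to T-≡ ey
                    , Equivalence.to T-not-≡ ¬z

-- The three disjuncts are the unfoldings of `HasTrace` omitting the third, first and second vertex;
-- `s` stands for the size test.
hits-two : ∀ a b c s → T (s ∧ (b2n a + b2n b + b2n c ≡ᵇ 2)) →
  T ((s ∧ (a ∧ (b ∧ not c))) ∨ ((s ∧ (b ∧ (c ∧ not a))) ∨ (s ∧ (a ∧ (c ∧ not b)))))
hits-two true  true  false true _ = tt
hits-two true  false true  true _ = tt
hits-two false true  true  true _ = tt
hits-two false true  false true ()
hits-two false false false true ()

-- Two missed vertices would form a pair that is not covered.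
two-hits : ∀ a b c → T a ⊎ T b → T b ⊎ T c → T a ⊎ T c → 2 ≤ b2n a + b2n b + b2n c
two-hits true  true  _     _ _ _ = s≤s (s≤s z≤n)
two-hits true  false true  _ _ _ = s≤s (s≤s z≤n)
two-hits true  false false _ (inj₁ ()) _
two-hits true  false false _ (inj₂ ()) _
two-hits false true  true  _ _ _ = s≤s (s≤s z≤n)
two-hits false true  false _ _ (inj₁ ())
two-hits false true  false _ _ (inj₂ ())
two-hits false false _ (inj₁ ()) _ _
two-hits false false _ (inj₂ ()) _ _

triangle-completion : ∀ {m} k (F : Family (3 + m)) → Uniform (3 + k) F → ∀ {t} →
  diversity F + t ≡ m C suc k → ∀ {a b c} → a ≢ b → b ≢ c → a ≢ c →
  Covering F a b → Covering F b c → Covering F a c →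
  Σ (Family (3 + m)) λ G → F ⊆F G × added F G ≤ 3 * t × TwoOutOfThree (3 + k) G
triangle-completion {m} k F uniform {t} d+t {a} {b} {c} a≢b b≢c a≢c ab bc ac =
  G , (λ E fE → ∨⁺ (F E) (inj₁ fE)) , added≤ ,
  a , b , c , a≢b , b≢c , a≢c , lower , upper
  where
  n r : ℕ
  n = 3 + m
  r = 3 + k
  two G : Family n
  two E = (∣ E ∣ ≡ᵇ r) ∧ (hits a b c E ≡ᵇ 2)
  -- The least family containing `F` and every `r`-set with exactly two triangle vertices. The
  -- coverings supply the upper condition for `F` itself.
  G E = F E ∨ two E
  lower : ∀ E → ∣ E ∣ ≡ r → hits a b c E ≡ 2 → T (G E)
  lower E s h = ∨⁺ (F E) (inj₂ (∧⁺ (≡⇒≡ᵇ _ r s) (≡⇒≡ᵇ _ 2 h)))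
  upper : ∀ E → T (G E) → ∣ E ∣ ≡ r × 2 ≤ hits a b c E
  upper E p with ∨⁻ (F E) p
  ... | inj₁ fE = uniform E fE , two-hits _ _ _ (ab E fE) (bc E fE) (ac E fE)
  ... | inj₂ q with ∧⁻ (∣ E ∣ ≡ᵇ r) q
  ...   | s , h = ≡ᵇ⇒≡ _ r s , ≤-reflexive (sym (≡ᵇ⇒≡ (hits a b c E) 2 h))
  M : Fin n → Fin n → Fin n → Subset n → Bool
  M x y z E = HasTrace r x y z E ∧ not (F E)
  classify : ∀ E → T (G E ∧ not (F E)) → T (M a b c E ∨ (M b c a E ∨ M a c b E))
  classify E p with ∧⁻ (G E) p
  ... | gE , ¬F with ∨⁻ (F E) gE
  ...   | inj₁ fE = contradiction fE (T-not⁻ ¬F)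
  ...   | inj₂ q with ∨⁻ (HasTrace r a b c E) (hits-two (lookup E a) (lookup E b) (lookup E c) _ q)
  ...     | inj₁ h = ∨⁺ (M a b c E) (inj₁ (∧⁺ h ¬F))
  ...     | inj₂ h with ∨⁻ (HasTrace r b c a E) h
  ...       | inj₁ h′ = ∨⁺ (M a b c E) (inj₂ (∨⁺ (M b c a E) (inj₁ (∧⁺ h′ ¬F))))
  ...       | inj₂ h′ = ∨⁺ (M a b c E) (inj₂ (∨⁺ (M b c a E) (inj₂ (∧⁺ h′ ¬F))))
  flip : ∀ {x y} → Covering F x y → Covering F y x
  flip xy E fE = [ inj₂ , inj₁ ]′ (xy E fE)
  deficit = trace-deficit k F uniform d+t
  open ≤-Reasoning
  added≤ : added F G ≤ 3 * t
  added≤ = begin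
    added F G
      ≤⟨ countB-mono _ _ classify (allSubsets n) ⟩
    countB (λ E → M a b c E ∨ (M b c a E ∨ M a c b E)) (allSubsets n)
      ≤⟨ countB-∨ (M a b c) _ (allSubsets n) ⟩
    countB (M a b c) (allSubsets n) + countB (λ E → M b c a E ∨ M a c b E) (allSubsets n)
      -- The missing sets are sorted by the triangle vertex they omit: `c`, then `a`, then `b`, with
      -- at most `t` of each kind.
      ≤⟨ +-mono-≤ (deficit a≢b a≢c b≢c ac bc)
           (≤-trans (countB-∨ (M b c a) _ (allSubsets n))
             (+-mono-≤ (deficit b≢c (≢-sym a≢b) (≢-sym a≢c) (flip ab) (flip ac))
                       (deficit a≢c a≢b (≢-sym b≢c) ab (flip bc)))) ⟩
    t + (t + t)
      ≡⟨ cong (λ s → t + (t + s)) (+-identityʳ t) ⟨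
    3 * t ∎

-- The fraction p/q plays the role of ε; a real ε below 1 is at most some such fraction. The
-- diversity condition is stated as a sum to avoid truncated subtraction.
theorem4 : (r : ℕ) → 3 ≤ r → (p q : ℕ) → 0 < p → p < q →
    Σ ℕ λ n₀ → (n : ℕ) → n₀ ≤ n → (t : ℕ) →
    q * t ≤ p * ((n ∸ 3) C (r ∸ 2)) →
    (F : Family n) → Uniform r F → Intersecting F →
    diversity F + t ≡ (n ∸ 3) C (r ∸ 2) →
    Σ (Family n) λ G → F ⊆F G × added F G ≤ 3 * t × TwoOutOfThree r G
theorem4 (suc (suc (suc k))) (s≤s (s≤s (s≤s _))) p q _ p<q =
  -- The threshold of `C-growth` for `W` equal to q r³, shifted by 3 because `m` is n-3. The factor
  -- r³ comes from `avoiding-≤` and `q` from `deficit-bound`.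
  3 + (k + suc (suc k * (q * (r * (r * r))))) , large
  where
  r : ℕ
  r = 3 + k
  reassociate : ∀ q r c → q * (r * (r * r)) * c ≡ q * (r * (r * (r * c)))
  reassociate = solve-∀
  large : (n : ℕ) → 3 + (k + suc (suc k * (q * (r * (r * r))))) ≤ n → (t : ℕ) →
    q * t ≤ p * ((n ∸ 3) C suc k) →
    (F : Family n) → Uniform r F → Intersecting F →
    diversity F + t ≡ (n ∸ 3) C suc k →
    Σ (Family n) λ G → F ⊆F G × added F G ≤ 3 * t × TwoOutOfThree r G
  large (suc (suc (suc m))) (s≤s (s≤s (s≤s n₀≤))) t qt≤pN F uniform intersecting d+t =
    let diverse = deficit-bound p<q qt≤pN d+t
          (subst (_< m C suc k) (reassociate q r (m C k)) (C-growth m k _ n₀≤))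
        a , b , c , ab , bc , ac = heavy-triangle F uniform intersecting diverse
        covering = heavy-covering F uniform intersecting
    in triangle-completion k F uniform d+t (proj₁ ab) (proj₁ bc) (proj₁ ac)
         (covering ab) (covering bc) (covering ac)
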